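{- Let $(X,\varphi)$ be a convex geometry and suppose the lattice $L:=Cl(X,\varphi)$ is weakly atomic. Then $L$ is spatial. Moreover, there exist a subset $Y\subseteq X$ and a closure operator $\psi$ on $Y$ satisfying the anti-exchange axiom such that $L$ is isomorphic to $Cl(Y,\psi)$ and $\psi(\{y\})$ is completely join-irreducible in $Cl(Y,\psi)$ for every $y\in Y$.
   Context: A convex geometry is a pair $(X,\varphi)$ where $X$ is a non-empty set and $\varphi$ is a closure operator on $X$ with $\varphi(\emptyset)=\emptyset$ satisfying the anti-exchange axiom: for all $\varphi$-closed $A$ and all $x\neq y$ in $X$, if $x\in\varphi(A\cup\{y\})$ and $x\notin A$ then $y\notin\varphi(A\cup\{x\})$. $Cl(X,\varphi)$ is the complete lattice of $\varphi$-closed sets ordered by inclusion. A lattice is weakly atomic if every interval $[a,b]$ with $a<b$ contains a cover $c\prec d$. An element $y$ of a complete lattice is completely join-irreducible if it has a lower cover $y_*$ such that $z<y$ implies $z\leq y_*$. A complete lattice is spatial if every element is a join of completely join-irreducible elements. -}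

module Defs where

open import Axiom.ExcludedMiddle using (ExcludedMiddle)
open import Data.Product using (∃; ∃-syntax; _×_; _,_; proj₁; proj₂)
open import Level using (Level; Lift; lift; lower; _⊔_) renaming (suc to lsuc)
open import Relation.Binary.Bundles using (Poset)
import Relation.Binary.Construct.On as On
open import Relation.Binary.Morphism.Structures using (IsOrderIsomorphism)
import Relation.Binary.Properties.Poset as PosetProperties
open import Relation.Binary.PropositionalEquality using (_≢_)
open import Relation.Nullary using (¬_)
open import Relation.Nullary.Decidable using (True; toWitness; fromWitness)
open import Relation.Unary using (Pred; _∈_; _∉_; _⊆_; _≐_; _∪_; ｛_｝)
open import Relation.Unary.Polymorphic using (∅)
open import Relation.Unary.Relation.Binary.Subset using (⊆-poset)

private
  variable
    ℓ p c₁ e₁ o₁ c₂ e₂ o₂ : Level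

module _ (P : Poset c₁ e₁ o₁) where
  open Poset P
  open PosetProperties P using (_<_)

  Covers : Carrier → Carrier → Set (c₁ ⊔ e₁ ⊔ o₁)
  Covers c d = c < d × ¬ (∃[ z ] c < z × z < d)

  WeaklyAtomic : Set (c₁ ⊔ e₁ ⊔ o₁)
  WeaklyAtomic = ∀ a b → a < b → ∃[ c ] ∃[ d ] a ≤ c × Covers c d × d ≤ b

  CompletelyJoinIrreducible : Carrier → Set (c₁ ⊔ e₁ ⊔ o₁)
  CompletelyJoinIrreducible y =
    ∃[ y⁎ ] Covers y⁎ y × (∀ z → z < y → z ≤ y⁎)

  IsJoin : Pred Carrier p → Carrier → Set (c₁ ⊔ o₁ ⊔ p)
  IsJoin S a = (∀ s → s ∈ S → s ≤ a) × (∀ b → (∀ s → s ∈ S → s ≤ b) → a ≤ b)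

  HasAllJoins : (p : Level) → Set (c₁ ⊔ o₁ ⊔ lsuc p)
  HasAllJoins p = (S : Pred Carrier p) → ∃ (IsJoin S)

  -- Only ever applied to lattices of closed sets, which are complete by
  -- Cl-hasAllJoins below.
  Spatial : Set (lsuc (c₁ ⊔ e₁ ⊔ o₁))
  Spatial = ∀ a → ∃[ S ] S ⊆ CompletelyJoinIrreducible × IsJoin {p = c₁ ⊔ e₁ ⊔ o₁} S a

infix 4 _≅_

_≅_ : Poset c₁ e₁ o₁ → Poset c₂ e₂ o₂ → Set (c₁ ⊔ e₁ ⊔ o₁ ⊔ c₂ ⊔ e₂ ⊔ o₂)
P ≅ Q = ∃ (IsOrderIsomorphism P._≈_ Q._≈_ P._≤_ Q._≤_)
  where
  module P = Poset P
  module Q = Poset Q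

record ClosureOperator (X : Set ℓ) : Set (lsuc ℓ) where
  field
    cl         : Pred X ℓ → Pred X ℓ
    extensive  : ∀ A → A ⊆ cl A
    monotone   : ∀ A B → A ⊆ B → cl A ⊆ cl B
    idempotent : ∀ A → cl (cl A) ≐ cl A

  IsClosed : Pred X ℓ → Set ℓ
  IsClosed A = cl A ≐ A

  -- Closed sets are compared by their underlying subsets only: the equality
  -- of the poset is mutual inclusion, and closedness proofs are ignored.
  Cl : Poset (lsuc ℓ) ℓ ℓ
  Cl = On.poset {B = ∃ IsClosed} (⊆-poset X ℓ) proj₁

  closure : Pred X ℓ → Poset.Carrier Cl
  closure A = cl A , idempotent A

  AntiExchange : Set (lsuc ℓ)
  AntiExchange = ∀ A → IsClosed A → ∀ x y → x ≢ y →
    x ∈ cl (A ∪ ｛ y ｝) → x ∉ A → y ∉ cl (A ∪ ｛ x ｝)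

  -- Excluded middle is used to bring the union of S, which quantifies over
  -- subsets of X, down to the universe of subsets of X.
  Cl-hasAllJoins : ExcludedMiddle (lsuc ℓ ⊔ p) → HasAllJoins Cl p
  Cl-hasAllJoins em S = closure ⋃S , upper , least
    where
    ⋃S : Pred X ℓ
    ⋃S x = Lift ℓ (True (em {∃[ C ] C ∈ S × x ∈ proj₁ C}))

    upper : ∀ C → C ∈ S → proj₁ C ⊆ cl ⋃S
    upper C C∈S x∈C = extensive ⋃S (lift (fromWitness (C , C∈S , x∈C)))

    least : ∀ D → (∀ C → C ∈ S → proj₁ C ⊆ proj₁ D) → cl ⋃S ⊆ proj₁ D
    least (D , clD≐D) S≤D x∈cl = proj₁ clD≐D (monotone ⋃S D ⋃S⊆D x∈cl)
      where
      ⋃S⊆D : ⋃S ⊆ D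
      ⋃S⊆D x∈⋃S with toWitness (lower x∈⋃S)
      ... | C , C∈S , x∈C = S≤D C C∈S x∈C

open ClosureOperator public using (Cl; closure; AntiExchange)

record IsConvexGeometry {X : Set ℓ} (φ : ClosureOperator X) : Set (lsuc ℓ) where
  open ClosureOperator φ using (cl)
  field
    nonEmpty     : X
    cl-∅         : cl ∅ ≐ ∅ {ℓ = ℓ}
    antiExchange : AntiExchange φ

{-# OPTIONS --safe #-}

-- By anti-exchange, a cover C ≺ D of closed sets adds exactly one point x, and
-- then φ{x} ∖ {x} = φ{x} ∩ C is closed, so φ{x} is completely join-irreducible.
-- Let Y be the set of points x with φ{x} ∖ {x} closed. If A is closed and
-- φ(A ∩ Y) were strictly below A, a cover between them would add a point of
-- A ∩ Y outside φ(A ∩ Y); hence A = φ(A ∩ Y). This gives spatiality, and it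
-- makes A ↦ A ∩ Y an isomorphism onto the closed sets of ψ(B) = φ(B) ∩ Y.

module Submission where

open import Defs
open import Axiom.ExcludedMiddle using (ExcludedMiddle)
open import Data.Irrelevant using ([_])
open import Data.Product using (Σ-syntax; ∃-syntax; _×_; _,_; proj₁; proj₂)
open import Data.Refinement
  using (Refinement-syntax; _,_; value; value-injective)
open import Data.Sum using (inj₁; inj₂; [_,_]′)
open import Function using (_∘_; id)
open import Level using (Level) renaming (suc to lsuc)
open import Relation.Binary.Bundles using (Poset)
import Relation.Binary.Properties.Poset as PosetProperties
open import Relation.Binary.PropositionalEquality using (_≡_; refl; cong; subst; sym)
open import Relation.Nullary using (¬_)
open import Relation.Nullary.Decidable using (decidable-stable; recompute)
open import Relation.Unary
  using (Pred; _∈_; _∉_; _⊆_; _∪_; _∩_; _∖_; _⊢_; ｛_｝)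

private
  variable
    ℓ : Level
    X : Set ℓ

module ClosureProperties {X : Set ℓ} (φ : ClosureOperator X) where
  open ClosureOperator φ
    using (cl; extensive; monotone; idempotent; IsClosed)

  cl⊆⇒isClosed : ∀ {A} → cl A ⊆ A → IsClosed A
  cl⊆⇒isClosed {A} clA⊆A = clA⊆A , extensive A

  cl-least : ∀ {A B} → IsClosed B → A ⊆ B → cl A ⊆ B
  cl-least {A} {B} (clB⊆B , _) A⊆B = clB⊆B ∘ monotone A B A⊆B

  ∩-isClosed : ∀ {A B} → IsClosed A → IsClosed B → IsClosed (A ∩ B)
  ∩-isClosed A-closed B-closed = cl⊆⇒isClosed λ x∈ →
    cl-least A-closed proj₁ x∈ , cl-least B-closed proj₂ x∈

  ∈-cl｛｝ : ∀ x → x ∈ cl ｛ x ｝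
  ∈-cl｛｝ x = extensive ｛ x ｝ refl

  cl｛｝⊆ : ∀ {x A} → IsClosed A → x ∈ A → cl ｛ x ｝ ⊆ A
  cl｛｝⊆ {A = A} A-closed x∈A = cl-least A-closed λ x≡y → subst A x≡y x∈A

  -- Phrased through the closure of one point, without quantifying over closed sets, so that it is a
  -- predicate at level `ℓ` and can serve as `Y`; `CompletelyJoinIrreducible` for `Cl φ` lives one
  -- level up.
  PuncturedClosed : Pred X ℓ
  PuncturedClosed x = IsClosed (cl ｛ x ｝ ∖ ｛ x ｝)

  -- A closed set strictly below `cl ｛ x ｝` omits `x`, since otherwise it would contain all of
  -- `cl ｛ x ｝`. So the punctured closure, being closed, is the greatest such set.
  puncturedClosed⇒CJI : ∀ {x} → x ∈ PuncturedClosed →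
    CompletelyJoinIrreducible (Cl φ) (closure φ ｛ x ｝)
  puncturedClosed⇒CJI {x} punctured =
    x⁎ , (lower<x , nothingBetween) , below
    where
    open Poset (Cl φ) using (Carrier; _≤_)
    open PosetProperties (Cl φ) using (_<_)

    x̂ x⁎ : Carrier
    x̂  = closure φ ｛ x ｝
    x⁎ = cl ｛ x ｝ ∖ ｛ x ｝ , punctured

    lower<x : x⁎ < x̂
    lower<x = proj₁ , λ (_ , x̂⊆x⁎) → proj₂ (x̂⊆x⁎ (∈-cl｛｝ x)) refl

    below : ∀ Z → Z < x̂ → Z ≤ x⁎
    below (Z , Z-closed) (Z⊆x̂ , Z≉x̂) w∈Z = Z⊆x̂ w∈Z , λ x≡w →
      Z≉x̂ (Z⊆x̂ , cl｛｝⊆ Z-closed (subst Z (sym x≡w) w∈Z))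

    nothingBetween : ¬ (∃[ Z ] x⁎ < Z × Z < x̂)
    nothingBetween (Z , (x⁎⊆Z , x⁎≉Z) , Z<x̂) = x⁎≉Z (x⁎⊆Z , below Z Z<x̂)

module Restriction {X : Set ℓ} (φ : ClosureOperator X) (Y : Pred X ℓ) where
  open ClosureOperator φ
    using (cl; extensive; monotone; idempotent; IsClosed)
  open ClosureProperties φ

  image : Pred [ x ∈ X ∣ x ∈ Y ] ℓ → Pred X ℓ
  image B x = ∃[ y ] y ∈ B × value y ≡ x

  image-⊆ : ∀ B (A : Pred X ℓ) → B ⊆ value ⊢ A → image B ⊆ A
  image-⊆ B A B⊆A (_ , y∈B , refl) = B⊆A y∈B

  ⊆-image : ∀ B → B ⊆ value ⊢ image B
  ⊆-image B {y} y∈B = y , y∈B , refl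

  traceCl : Pred [ x ∈ X ∣ x ∈ Y ] ℓ → Pred [ x ∈ X ∣ x ∈ Y ] ℓ
  traceCl B = value ⊢ cl (image B)

  ψ : ClosureOperator [ x ∈ X ∣ x ∈ Y ]
  ψ = record
    { cl         = traceCl
    ; extensive  = λ B → extensive (image B) ∘ ⊆-image B
    ; monotone   = λ A B A⊆B →
        monotone (image A) (image B) (image-⊆ A (image B) (⊆-image B ∘ A⊆B))
    ; idempotent = λ B →
        cl-least (idempotent (image B)) (image-⊆ (traceCl B) _ id)
        , λ {y} → extensive (image (traceCl B)) ∘ ⊆-image (traceCl B) {y}
    }

  private
    module ψ where
      open ClosureOperator ψ public
      open ClosureProperties ψ public

  -- Anti-exchange of `φ` is applied to `cl (image A)`, whose points in `Y` all lie in `A` when `A`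
  -- is closed for `ψ`. Membership proofs are irrelevant in the refinement type, so distinct
  -- elements have distinct values.
  antiExchange : AntiExchange φ → AntiExchange ψ
  antiExchange φ-ae A (clA⊆A , _) x y x≢y x∈ x∉A y∈ =
    φ-ae (cl (image A)) (idempotent (image A)) (value x) (value y)
      (x≢y ∘ value-injective) (enlarge x∈) (x∉A ∘ clA⊆A) (enlarge y∈)
    where
    enlarge : ∀ {z} → cl (image (A ∪ ｛ z ｝)) ⊆ cl (cl (image A) ∪ ｛ value z ｝)
    enlarge {z} = monotone (image (A ∪ ｛ z ｝)) (cl (image A) ∪ ｛ value z ｝)
      (image-⊆ (A ∪ ｛ z ｝) (cl (image A) ∪ ｛ value z ｝)
        [ inj₁ ∘ extensive (image A) ∘ ⊆-image A , inj₂ ∘ cong value ]′)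

  trace-isClosed : ∀ {A} → IsClosed A → ψ.IsClosed (value ⊢ A)
  trace-isClosed {A} A-closed =
    ψ.cl⊆⇒isClosed (cl-least A-closed (image-⊆ (value ⊢ A) A id))

  -- Up to mutual inclusion, the punctured `ψ`-closure of `y` is the trace of the punctured closure
  -- of `value y`, and traces of closed sets are closed.
  puncturedClosed : ∀ y → value y ∈ PuncturedClosed → y ∈ ψ.PuncturedClosed
  puncturedClosed y punctured = ψ.cl⊆⇒isClosed λ z∈ →
    let z∈cl , y≢z = cl-least punctured (image-⊆ (ψ.cl ｛ y ｝ ∖ ｛ y ｝) _ shrink) z∈
    in cl-least (idempotent _) (λ { refl → extensive _ (⊆-image ｛ y ｝ refl) }) z∈cl
       , y≢z ∘ cong value
    where
    shrink : ψ.cl ｛ y ｝ ∖ ｛ y ｝ ⊆ value ⊢ (cl ｛ value y ｝ ∖ ｛ value y ｝)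
    shrink (z∈cl , y≢z) =
      monotone _ ｛ value y ｝ (image-⊆ ｛ y ｝ _ (cong value)) z∈cl
      , y≢z ∘ value-injective

  IsDense : Set (lsuc ℓ)
  IsDense = ∀ {A} → IsClosed A → A ⊆ cl (A ∩ Y)

  -- Density recovers a closed set from its trace, so inclusion of traces gives inclusion of sets. A
  -- `ψ`-closed `B` is the trace of `cl (image B)`.
  trace-isomorphism : IsDense → Cl φ ≅ Cl ψ
  trace-isomorphism dense = trace , record
    { isOrderMonomorphism = record
      { isOrderHomomorphism = record
        { cong = λ (A⊆B , B⊆A) → (λ w∈ → A⊆B w∈) , λ w∈ → B⊆A w∈
        ; mono = λ A⊆B w∈ → A⊆B w∈
        }
      ; injective = λ {A} {B} (A⊆B , B⊆A) →
          reflect A B (λ {w} → A⊆B {w}) , reflect B A (λ {w} → B⊆A {w})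
      ; cancel    = λ {A} {B} → reflect A B
      }
    ; surjective = λ (B , clB⊆B , B⊆clB) →
        closure φ (image B)
        , λ (C⊆ , ⊆C) → clB⊆B ∘ C⊆ , ⊆C ∘ B⊆clB
    }
    where
    open Poset (Cl φ) using (Carrier; _≤_)
    trace : Carrier → Poset.Carrier (Cl ψ)
    trace (A , A-closed) = value ⊢ A , trace-isClosed A-closed

    reflect : ∀ A B → Poset._≤_ (Cl ψ) (trace A) (trace B) → A ≤ B
    reflect (A , A-closed) (B , B-closed) A∩Y⊆B w∈A =
      cl-least B-closed (λ (w∈A , w∈Y) → A∩Y⊆B {_ , [ w∈Y ]} w∈A)
        (dense A-closed w∈A)

module ConvexGeometry
  (em : ∀ {p} → ExcludedMiddle p) {X : Set ℓ} (φ : ClosureOperator X)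
  (antiExchange : AntiExchange φ)
  where
  open ClosureOperator φ using (cl; extensive; idempotent)
  open ClosureProperties φ

  module _ (C D : Poset.Carrier (Cl φ)) (C≺D : Covers (Cl φ) C D) where
    private
      C-closed = proj₂ C
      D-closed = proj₂ D
      C⊆D      = proj₁ (proj₁ C≺D)

    -- Otherwise `cl (C ∪ ｛ x ｝)` would lie strictly between `C` and `D`.
    cover-generates : ∀ {x} → x ∈ proj₁ D → x ∉ proj₁ C →
      proj₁ D ⊆ cl (proj₁ C ∪ ｛ x ｝)
    cover-generates {x} x∈D x∉C = decidable-stable em λ D⊈C∪x →
      proj₂ C≺D
        ( closure φ (proj₁ C ∪ ｛ x ｝)
        , (extensive _ ∘ inj₁
          , λ (_ , C∪x⊆C) → x∉C (C∪x⊆C (extensive _ (inj₂ refl))))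
        , cl-least D-closed [ C⊆D , (λ { refl → x∈D }) ]′
        , λ (_ , D⊆C∪x) → D⊈C∪x D⊆C∪x)

    -- Two distinct points of `D` outside `C` would each lie in the closure of `C` with the other
    -- added, against anti-exchange.
    cover-singleton : ∀ {x} → x ∈ proj₁ D → x ∉ proj₁ C →
      proj₁ D ∖ ｛ x ｝ ⊆ proj₁ C
    cover-singleton {x} x∈D x∉C (w∈D , x≢w) = decidable-stable em λ w∉C →
      antiExchange (proj₁ C) C-closed x _ x≢w
        (cover-generates w∈D w∉C x∈D) x∉C (cover-generates x∈D x∉C w∈D)

    cover-puncturedClosed : ∀ {x} → x ∈ proj₁ D → x ∉ proj₁ C → x ∈ PuncturedClosed
    cover-puncturedClosed {x} x∈D x∉C = cl⊆⇒isClosed λ w∈ →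
      -- The intersection with `C` is closed and omits `x`, so closing the punctured set does not
      -- bring `x` back.
      let w∈x̂ , w∈C = cl-least (∩-isClosed (idempotent ｛ x ｝) C-closed) ⊆∩ w∈
      in w∈x̂ , λ { refl → x∉C w∈C }
      where
      ⊆∩ : cl ｛ x ｝ ∖ ｛ x ｝ ⊆ cl ｛ x ｝ ∩ proj₁ C
      ⊆∩ (w∈x̂ , x≢w) =
        w∈x̂ , cover-singleton x∈D x∉C (cl｛｝⊆ D-closed x∈D w∈x̂ , x≢w)

    -- Strictness of a cover only refutes mutual inclusion; excluded middle extracts a witness.
    cover-newPoint : ∃[ x ] x ∈ proj₁ D × x ∉ proj₁ C
    cover-newPoint = decidable-stable em λ none →
      proj₂ (proj₁ C≺D) (C⊆D , λ x∈D →
        decidable-stable em λ x∉C → none (_ , x∈D , x∉C))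

  puncturedClosed-dense : WeaklyAtomic (Cl φ) → Restriction.IsDense φ PuncturedClosed
  puncturedClosed-dense weaklyAtomic {A} A-closed = decidable-stable em λ A⊈B →
    let C , D , B⊆C , C≺D , D⊆A = weaklyAtomic (closure φ (A ∩ PuncturedClosed))
          (A , A-closed) (cl-least A-closed proj₁ , λ (_ , A⊆B) → A⊈B A⊆B)
        x , x∈D , x∉C = cover-newPoint C D C≺D
    -- The new point lies in `A` and in `PuncturedClosed`, hence in the generated set contained in
    -- `C`.
    in x∉C (B⊆C (extensive _ (D⊆A x∈D , cover-puncturedClosed C D C≺D x∈D x∉C)))

-- The join is taken over all completely join-irreducible elements below `A`. An upper bound of them
-- contains `cl ｛ x ｝` for each punctured-closed point `x` of `A`, and these points generate `A`.
dense⇒spatial : (φ : ClosureOperator X) →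
  Restriction.IsDense φ (ClosureProperties.PuncturedClosed φ) → Spatial (Cl φ)
dense⇒spatial φ dense (A , A-closed) =
  (λ Z → CompletelyJoinIrreducible (Cl φ) Z × Z ≤ (A , A-closed))
  , proj₁
  , (λ _ → proj₂)
  , λ (B , B-closed) upper w∈A → cl-least B-closed
      (λ {x} (x∈A , punctured) →
        upper (closure φ ｛ x ｝) (puncturedClosed⇒CJI punctured , cl｛｝⊆ A-closed x∈A)
          (∈-cl｛｝ x))
      (dense A-closed w∈A)
  where
  open ClosureProperties φ
  open Poset (Cl φ) using (_≤_)

theorem3p1 : (∀ {p} → ExcludedMiddle p) →
    ∀ {ℓ} {X : Set ℓ} (φ : ClosureOperator X) →
    IsConvexGeometry φ →
    WeaklyAtomic (Cl φ) →
    Spatial (Cl φ) ×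
    (Σ[ Y ∈ Pred X ℓ ] Σ[ ψ ∈ ClosureOperator [ x ∈ X ∣ x ∈ Y ] ]
    AntiExchange ψ ×
    (Cl φ ≅ Cl ψ) ×
    (∀ y → CompletelyJoinIrreducible (Cl ψ) (closure ψ ｛ y ｝)))
theorem3p1 em φ geometry weaklyAtomic =
  dense⇒spatial φ dense
  , PuncturedClosed , ψ
  , Restriction.antiExchange φ PuncturedClosed φ-antiExchange
  , trace-isomorphism dense
  , λ where
      -- The membership proof is irrelevant here; excluded middle decides membership, so a usable
      -- proof can be recovered.
      y@(_ , [ y∈Y ]) → ClosureProperties.puncturedClosed⇒CJI ψ
        (puncturedClosed y (recompute em y∈Y))
  where
  open ClosureProperties φ using (PuncturedClosed)
  open Restriction φ PuncturedClosed
    using (ψ; trace-isomorphism; puncturedClosed)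
  open IsConvexGeometry geometry renaming (antiExchange to φ-antiExchange)
  open ConvexGeometry em φ φ-antiExchange using (puncturedClosed-dense)

  dense : Restriction.IsDense φ PuncturedClosed
  dense = puncturedClosed-dense weaklyAtomic
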